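{- Let $R \cong R_1\times\cdots\times R_r$ ($r\ge 1$) with finite commutative local rings $R_i$. Then the number of vertices of the compressed zero-divisor graph $\Gamma_E(R)$ equals $$\# V(\Gamma_E(R)) = \prod_{i=1}^r\big(\# V(\Gamma_E(R_i)) + 2\big) - 2 = \prod_{i=1}^r \#(R_i)_E - 2 .$$
   Context: Rings are finite and commutative with $1\neq 0$. For $r\in R$ let $[r]_R=\{s\in R \mid \mathrm{ann}_R(r)=\mathrm{ann}_R(s)\}$, and let $R_E=\{[r]_R \mid r\in R\}$. One has $[0]_R=\{0\}$, and $[1]_R$ is the set of units of $R$. The compressed zero-divisor graph $\Gamma_E(R)$ has vertex set $R_E\setminus\{[0]_R,[1]_R\}$ (the classes of non-zero zero-divisors), with $[x]_R,[y]_R$ adjacent iff $xy=0$. $\#S$ is the cardinality of a set $S$. -}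

module Defs where

open import Algebra.Bundles using (CommutativeRing)
open import Algebra.Morphism.Structures using (module RingMorphisms)
open import Data.Fin.Base using (Fin; zero; suc)
open import Data.Fin.Properties using (all?) renaming (_≟_ to _≟ᶠ_)
open import Data.List.Base using (List; []; _∷_; length; lookup; tabulate; concatMap; deduplicate)
open import Data.List.Membership.Setoid.Properties using (∈-lookup; ∈-tabulate⁺; ∈-resp-≈)
import Data.List.Relation.Unary.All as All
open import Data.List.Relation.Unary.AllPairs using (_∷_)
open import Data.List.Relation.Unary.Any as Any using (Any; here)
import Data.List.Relation.Unary.Any.Properties as Any
open import Data.List.Relation.Unary.Enumerates.Setoid using (IsEnumeration)
open import Data.List.Relation.Unary.Enumerates.Setoid.Properties using (deduplicate⁺; lookup-surjective)
open import Data.List.Relation.Unary.Unique.Setoid using (Unique)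
open import Data.List.Relation.Unary.Unique.DecSetoid.Properties using (deduplicate-!)
open import Data.Nat.Base using (ℕ)
open import Data.Product.Base using (Σ; ∃; _×_; _,_; proj₁; proj₂)
open import Function.Base using (_∘_)
open import Function.Bundles using (Bijection)
open import Function.Definitions using (Injective)
open import Level using (Level; _⊔_) renaming (suc to lsuc)
open import Relation.Binary.Bundles using (Setoid; DecSetoid)
open import Relation.Binary.Core using (Rel)
open import Relation.Binary.Definitions using (Decidable; Symmetric; _Respects₂_)
import Relation.Binary.Construct.On as On
open import Relation.Binary.PropositionalEquality using (_≡_; refl)
import Relation.Binary.PropositionalEquality as ≡
open import Relation.Nullary.Decidable using (Dec; yes; no; map′; _×-dec_; _→-dec_; ¬?)
open import Relation.Nullary.Negation using (¬_; contradiction)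
open import Relation.Unary using (Pred; _∈_; _⊆_; _≐_; Universal; _⊆′_)
open import Relation.Unary.Relation.Binary.Equality using (≐-setoid)

private
  variable
    a c d ℓ ℓ′ p : Level

record Finite (S : Setoid a ℓ) : Set (a ⊔ ℓ) where
  field
    size        : ℕ
    enumeration : Bijection (≡.setoid (Fin size)) S

record FiniteSetoid a ℓ : Set (lsuc (a ⊔ ℓ)) where
  field
    setoid : Setoid a ℓ
    finite : Finite setoid

# : FiniteSetoid a ℓ → ℕ
# S = Finite.size (FiniteSetoid.finite S)

module _ {S : Setoid a ℓ} (fin : Finite S) where
  open Setoid S renaming (refl to ≈-refl; sym to ≈-sym; trans to ≈-trans)
  open Finite fin
  open Bijection enumeration

  to-to⁻ : ∀ x → to (to⁻ x) ≈ x
  to-to⁻ x = proj₂ (surjective x) refl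

  finite⇒dec : Decidable _≈_
  finite⇒dec x y = map′
    (λ eq → ≈-trans (≈-sym (to-to⁻ x)) (≈-trans (cong eq) (to-to⁻ y)))
    (λ eq → injective (≈-trans (to-to⁻ x) (≈-trans eq (≈-sym (to-to⁻ y)))))
    (to⁻ x ≟ᶠ to⁻ y)

  finite⇒∀? : {P : Pred Carrier p} → (∀ {x y} → x ≈ y → P x → P y) →
              (∀ x → Dec (P x)) → Dec (∀ x → P x)
  finite⇒∀? resp P? = map′
    (λ h x → resp (to-to⁻ x) (h (to⁻ x))) (λ h i → h (to i)) (all? (P? ∘ to))

  elements : List Carrier
  elements = tabulate to

  elements-enumerate : IsEnumeration S elements
  elements-enumerate x = ∈-resp-≈ S (to-to⁻ x) (∈-tabulate⁺ S (to⁻ x))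

lookup-injective : (S : Setoid a ℓ) {xs : List (Setoid.Carrier S)} → Unique S xs →
                   Injective _≡_ (Setoid._≈_ S) (lookup xs)
lookup-injective S {_ ∷ _}  (_ ∷ _)  {zero}  {zero}  _  = refl
lookup-injective S {_ ∷ xs} (x# ∷ _) {zero}  {suc j} eq =
  contradiction eq (All.lookupₛ S (λ e ne → ne ∘ λ q → Setoid.trans S q (Setoid.sym S e)) x# (∈-lookup S xs j))
lookup-injective S {_ ∷ xs} (x# ∷ _) {suc i} {zero}  eq =
  contradiction (Setoid.sym S eq) (All.lookupₛ S (λ e ne → ne ∘ λ q → Setoid.trans S q (Setoid.sym S e)) x# (∈-lookup S xs i))
lookup-injective S {_ ∷ _}  (_ ∷ u)  {suc i} {suc j} eq = ≡.cong suc (lookup-injective S u eq)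

enumeration⇒finite : (S : DecSetoid a ℓ) (xs : List (DecSetoid.Carrier S)) →
                     IsEnumeration (DecSetoid.setoid S) xs → Finite (DecSetoid.setoid S)
enumeration⇒finite S xs all = record
  { size        = length (deduplicate _≟_ xs)
  ; enumeration = record
    { to        = lookup (deduplicate _≟_ xs)
    ; cong      = λ eq → Setoid.reflexive setoid (≡.cong (lookup (deduplicate _≟_ xs)) eq)
    ; bijective = lookup-injective setoid (deduplicate-! S xs)
                , lookup-surjective setoid (deduplicate⁺ S all)
    }
  } where open DecSetoid S

record FiniteCommutativeRing c ℓ : Set (lsuc (c ⊔ ℓ)) where
  field
    commutativeRing : CommutativeRing c ℓ
  open CommutativeRing commutativeRing public
  field
    1≉0    : ¬ (1# ≈ 0#)
    finite : Finite setoid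

_≅_ : CommutativeRing c ℓ → CommutativeRing d ℓ′ → Set (c ⊔ ℓ ⊔ d ⊔ ℓ′)
R ≅ S = ∃ (RingMorphisms.IsRingIsomorphism (CommutativeRing.rawRing R) (CommutativeRing.rawRing S))

infix 4 _≅_

open FiniteCommutativeRing public using (commutativeRing)

∏ : {I : Set a} → (I → CommutativeRing c ℓ) → CommutativeRing (a ⊔ c) (a ⊔ ℓ)
∏ R = record
  { Carrier = ∀ i → Carrier (R i)
  ; _≈_ = λ x y → ∀ i → _≈_ (R i) (x i) (y i)
  ; _+_ = λ x y i → _+_ (R i) (x i) (y i)
  ; _*_ = λ x y i → _*_ (R i) (x i) (y i)
  ; -_  = λ x i → -_ (R i) (x i)
  ; 0#  = λ i → 0# (R i)
  ; 1#  = λ i → 1# (R i)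
  ; isCommutativeRing = record
    { isRing = record
      { +-isAbelianGroup = record
        { isGroup = record
          { isMonoid = record
            { isSemigroup = record
              { isMagma = record
                { isEquivalence = record
                  { refl  = λ i → CommutativeRing.refl (R i)
                  ; sym   = λ p i → CommutativeRing.sym (R i) (p i)
                  ; trans = λ p q i → CommutativeRing.trans (R i) (p i) (q i)
                  }
                ; ∙-cong = λ p q i → +-cong (R i) (p i) (q i)
                }
              ; assoc = λ x y z i → +-assoc (R i) (x i) (y i) (z i)
              }
            ; identity = (λ x i → +-identityˡ (R i) (x i)) , (λ x i → +-identityʳ (R i) (x i))
            }
          ; inverse = (λ x i → -‿inverseˡ (R i) (x i)) , (λ x i → -‿inverseʳ (R i) (x i))
          ; ⁻¹-cong = λ p i → -‿cong (R i) (p i)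
          }
        ; comm = λ x y i → +-comm (R i) (x i) (y i)
        }
      ; *-cong     = λ p q i → *-cong (R i) (p i) (q i)
      ; *-assoc    = λ x y z i → *-assoc (R i) (x i) (y i) (z i)
      ; *-identity = (λ x i → *-identityˡ (R i) (x i)) , (λ x i → *-identityʳ (R i) (x i))
      ; distrib    = (λ x y z i → distribˡ (R i) (x i) (y i) (z i))
                   , (λ x y z i → distribʳ (R i) (x i) (y i) (z i))
      }
    ; *-comm = λ x y i → *-comm (R i) (x i) (y i)
    }
  } where open CommutativeRing

module _ (R : CommutativeRing c ℓ) where
  open CommutativeRing R using (Carrier; _≈_; _+_; _*_; 0#)

  record IsIdeal (I : Pred Carrier p) : Set (c ⊔ ℓ ⊔ p) where
    field
      resp     : ∀ {x y} → x ≈ y → x ∈ I → y ∈ I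
      0∈       : 0# ∈ I
      +-closed : ∀ {x y} → x ∈ I → y ∈ I → (x + y) ∈ I
      *-closed : ∀ r {x} → x ∈ I → (r * x) ∈ I

  -- Maximality among proper ideals.  The common form "every ideal above M is
  -- M or R" is a disjunction that cannot be decided for arbitrary subsets.
  record IsMaximalIdeal (M : Pred Carrier p) : Set (c ⊔ ℓ ⊔ lsuc p) where
    field
      isIdeal : IsIdeal M
      proper  : ¬ Universal M
      maximal : ∀ {J : Pred Carrier p} → IsIdeal J → ¬ Universal J → M ⊆ J → J ⊆ M

  -- Subsets have to live at a fixed universe level.  Level c ⊔ ℓ contains the
  -- principal ideals and the set of non-units.
  IsLocal : Set (lsuc (c ⊔ ℓ))
  IsLocal = Σ (Pred Carrier (c ⊔ ℓ)) λ M →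
    IsMaximalIdeal M × (∀ {N : Pred Carrier (c ⊔ ℓ)} → IsMaximalIdeal N → N ≐ M)

record FiniteGraph v e ℓ : Set (lsuc (v ⊔ e ⊔ ℓ)) where
  field
    V : FiniteSetoid v e
  open Setoid (FiniteSetoid.setoid V) using (Carrier; _≈_)
  field
    Adjacent      : Rel Carrier ℓ
    Adjacent-sym  : Symmetric Adjacent
    Adjacent-resp : Adjacent Respects₂ _≈_

open FiniteGraph public using (V)

module _ (R : FiniteCommutativeRing c ℓ) where
  open FiniteCommutativeRing R
    using (Carrier; _≈_; _*_; 0#; 1#; setoid; finite; *-comm; *-congˡ)
    renaming (sym to ≈-sym; trans to ≈-trans)

  ann : Carrier → Pred Carrier ℓ
  ann r t = r * t ≈ 0#

  [_] : Carrier → Pred Carrier (c ⊔ ℓ)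
  [ r ] s = ann r ≐ ann s

  -- The class [ r ] is represented by r: the elements are those of R, and
  -- x ≈ᴱ y means that [ x ] and [ y ] are equal as subsets of R.
  classes : Setoid c (c ⊔ ℓ)
  classes = On.setoid (≐-setoid Carrier (c ⊔ ℓ)) [_]

  open Setoid classes public using () renaming (_≈_ to _≈ᴱ_)

  ≈ᴱ⇒ann : ∀ {x y} → x ≈ᴱ y → ann x ≐ ann y
  ≈ᴱ⇒ann {x} {y} (_ , [y]⊆[x]) = [y]⊆[x] ((λ t → t) , (λ t → t))

  ann⇒≈ᴱ : ∀ {x y} → ann x ≐ ann y → x ≈ᴱ y
  ann⇒≈ᴱ (x⊆y , y⊆x) =
      (λ (x⊆s , s⊆x) → (λ t → x⊆s (y⊆x t)) , (λ t → x⊆y (s⊆x t)))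
    , (λ (y⊆s , s⊆y) → (λ t → y⊆s (x⊆y t)) , (λ t → y⊆x (s⊆y t)))

  ann-resp : ∀ x {s t} → s ≈ t → s ∈ ann x → t ∈ ann x
  ann-resp x s≈t xs≈0 = ≈-trans (*-congˡ (≈-sym s≈t)) xs≈0

  ann-⊆? : ∀ x y → Dec (ann x ⊆′ ann y)
  ann-⊆? x y = finite⇒∀? finite
    (λ s≈t f xt → ann-resp y s≈t (f (ann-resp x (≈-sym s≈t) xt)))
    (λ t → finite⇒dec finite (x * t) 0# →-dec finite⇒dec finite (y * t) 0#)

  _≈ᴱ?_ : Decidable _≈ᴱ_
  x ≈ᴱ? y = map′
    (λ (f , g) → ann⇒≈ᴱ {x} {y} ((λ {t} → f t) , (λ {t} → g t)))
    (λ e → (λ t → proj₁ (≈ᴱ⇒ann {x} {y} e) {t}) , (λ t → proj₂ (≈ᴱ⇒ann {x} {y} e) {t}))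
    (ann-⊆? x y ×-dec ann-⊆? y x)

  ≈⇒≈ᴱ : ∀ {x y} → x ≈ y → x ≈ᴱ y
  ≈⇒≈ᴱ {x} {y} x≈y = ann⇒≈ᴱ {x} {y}
    ( (λ {t} xt → ≈-trans (FiniteCommutativeRing.*-congʳ R (≈-sym x≈y)) xt)
    , (λ {t} yt → ≈-trans (FiniteCommutativeRing.*-congʳ R x≈y) yt))

  classes-dec : DecSetoid c (c ⊔ ℓ)
  classes-dec = record
    { isDecEquivalence = record { isEquivalence = Setoid.isEquivalence classes ; _≟_ = _≈ᴱ?_ } }

  R_E : FiniteSetoid c (c ⊔ ℓ)
  R_E = record
    { setoid = classes
    ; finite = enumeration⇒finite classes-dec (elements finite)
        (λ x → Any.map (λ {y} → ≈⇒≈ᴱ {x} {y}) (elements-enumerate finite x))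
    }

  IsVertex : Pred Carrier (c ⊔ ℓ)
  IsVertex x = ¬ (x ≈ᴱ 0#) × ¬ (x ≈ᴱ 1#)

  IsVertex? : ∀ x → Dec (IsVertex x)
  IsVertex? x = ¬? (x ≈ᴱ? 0#) ×-dec ¬? (x ≈ᴱ? 1#)

  vertices : Setoid (c ⊔ ℓ) (c ⊔ ℓ)
  vertices = On.setoid {B = Σ Carrier IsVertex} classes proj₁

  vertices-dec : DecSetoid (c ⊔ ℓ) (c ⊔ ℓ)
  vertices-dec = record
    { isDecEquivalence = record
      { isEquivalence = Setoid.isEquivalence vertices
      ; _≟_           = λ x y → proj₁ x ≈ᴱ? proj₁ y
      }
    }

  vertex : Carrier → List (Σ Carrier IsVertex)
  vertex x with IsVertex? x
  ... | yes v = (x , v) ∷ []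
  ... | no  _ = []

  ∈-vertex : ∀ x (v : IsVertex x) y → x ≈ y →
             Any (λ w → x ≈ᴱ proj₁ w) (vertex y)
  ∈-vertex x v y x≈y with IsVertex? y
  ... | yes _  = here (≈⇒≈ᴱ {x} {y} x≈y)
  ... | no  ¬v = contradiction
    ( (λ e → proj₁ v (Setoid.trans classes {x} {y} {0#} (≈⇒≈ᴱ {x} {y} x≈y) e))
    , (λ e → proj₂ v (Setoid.trans classes {x} {y} {1#} (≈⇒≈ᴱ {x} {y} x≈y) e))) ¬v

  Γ_E : FiniteGraph (c ⊔ ℓ) (c ⊔ ℓ) ℓ
  Γ_E = record
    { V = record
      { setoid = vertices
      ; finite = enumeration⇒finite vertices-dec (concatMap vertex (elements finite))
          (λ (x , v) → Any.concatMap⁺ vertex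
            (Any.map (λ {y} → ∈-vertex x v y) (elements-enumerate finite x)))
      }
    ; Adjacent      = λ (x , _) (y , _) → x * y ≈ 0#
    ; Adjacent-sym  = λ {(x , _)} {(y , _)} → comm-zero x y
    ; Adjacent-resp =
        (λ {(x , _)} {(y , _)} {(z , _)} e xy → comm-zero z x (proj₁ (≈ᴱ⇒ann {y} {z} e) (comm-zero x y xy)))
      , (λ {(x , _)} {(y , _)} {(z , _)} e yx → proj₁ (≈ᴱ⇒ann {y} {z} e) yx)
    }
    where
    comm-zero : ∀ x y → x * y ≈ 0# → y * x ≈ 0#
    comm-zero x y = ≈-trans (*-comm y x)

{-# OPTIONS --safe #-}

-- In a product of rings, annihilators are computed coordinatewise, so the
-- class of x is determined by the classes of its coordinates, which can be
-- chosen independently: R_E is in bijection with the product of the (Rᵢ)_E.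
-- In every ring, removing the two distinct classes [0] and [1] from R_E
-- leaves the vertices of Γ_E.

module Submission where

open import Algebra.Bundles using (CommutativeRing)
open import Algebra.Morphism.Structures using (module RingMorphisms)
open import Defs
open import Data.Fin.Base using (Fin; zero; suc)
open import Data.Fin.Permutation using (↔⇒≡)
open import Data.Fin.Properties using (+↔⊎; *↔×; _≟_)
open import Data.Integer.Base using (+_; _-_)
import Data.Integer.Properties as ℤ
open import Data.List.Base using (product; tabulate)
open import Data.List.Properties using (tabulate-cong)
open import Data.Nat.Base using (ℕ; zero; suc; _≥_; _+_)
import Data.Nat.Properties as ℕ
open import Data.Product.Base using (_×_; _,_; proj₁; proj₂)
open import Data.Product.Function.NonDependent.Setoid using (_×-inverse_)
open import Data.Product.Relation.Binary.Pointwise.NonDependent as ×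
  using (_×ₛ_)
open import Data.Sum.Base using (inj₁; inj₂)
open import Data.Sum.Function.Setoid using (_⊎-inverse_)
open import Data.Sum.Relation.Binary.Pointwise as ⊎ using (_⊎ₛ_; inj₁; inj₂)
open import Function.Base using (_∘_)
open import Function.Bundles using (Bijection; Inverse)
open import Function.Properties.Bijection using (Bijection⇒Inverse)
import Function.Properties.Inverse as Inv
open import Level using (Level)
open import Relation.Binary.Bundles using (Setoid)
open import Relation.Binary.PropositionalEquality using (_≡_; refl; sym; trans; cong; setoid)
open import Relation.Nullary.Decidable using (yes; no)
open import Relation.Nullary.Negation using (¬_; contradiction)

private
  variable
    a c c′ ℓ ℓ′ : Level
    n r : ℕ

-- Two-sided inverses rather than bijections, since these compose, reverse and combine over products
-- and sums.
Enumerated : ℕ → Setoid a ℓ → Set _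
Enumerated n S = Inverse (setoid (Fin n)) S

enumerated : {S : Setoid a ℓ} (fin : Finite S) → Enumerated (Finite.size fin) S
enumerated fin = Bijection⇒Inverse (Finite.enumeration fin)

-- Two enumerations of `S` compose to a bijection between `Fin` sets, which forces equal sizes. Each
-- count below thus reduces to exhibiting some enumeration.
size-unique : {S : Setoid a ℓ} (fin : Finite S) → Enumerated n S → Finite.size fin ≡ n
size-unique fin e = ↔⇒≡ (Inv.trans (enumerated fin) (Inv.sym e))

-- Families have the same shape as elements of `∏`, so a ring isomorphism onto `∏` can itself serve
-- as the map on classes.
Πₛ : (Fin r → Setoid a ℓ) → Setoid a ℓ
Πₛ S = record
  { Carrier       = ∀ i → Setoid.Carrier (S i)
  ; _≈_           = λ f g → ∀ i → Setoid._≈_ (S i) (f i) (g i)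
  ; isEquivalence = record
    { refl  = λ i → Setoid.refl (S i)
    ; sym   = λ p i → Setoid.sym (S i) (p i)
    ; trans = λ p q i → Setoid.trans (S i) (p i) (q i)
    }
  }

Π-cons : (S : Fin (suc r) → Setoid a ℓ) → Inverse (S zero ×ₛ Πₛ (S ∘ suc)) (Πₛ S)
Π-cons S = record
  { to        = λ { (x , f) zero → x ; (x , f) (suc i) → f i }
  ; from      = λ f → f zero , f ∘ suc
  ; to-cong   = λ { (p , q) zero → p ; (p , q) (suc i) → q i }
  ; from-cong = λ p → p zero , p ∘ suc
  ; inverse   = (λ { (p , q) zero → p ; (p , q) (suc i) → q i })
              , (λ p → p zero , p ∘ suc)
  }

Π-enumerated : ∀ r {S : Fin r → Setoid a ℓ} {size : Fin r → ℕ} →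
               (∀ i → Enumerated (size i) (S i)) → Enumerated (product (tabulate size)) (Πₛ S)
-- Up to coordinatewise equality there is exactly one empty family, matching the empty product 1.
Π-enumerated zero    e = record
  { to        = λ _ ()
  ; from      = λ _ → zero
  ; to-cong   = λ _ ()
  ; from-cong = λ _ → refl
  ; inverse   = (λ _ ()) , λ { {zero} _ → refl }
  }
Π-enumerated (suc r) {S} e =
  Inv.trans *↔×
  -- `*↔×` lands in pairs under propositional equality; this passes to componentwise equality, where
  -- the enumerations of head and tail combine.
  (Inv.trans (Inv.sym ×.Pointwise-≡↔≡)
  (Inv.trans (e zero ×-inverse Π-enumerated r (e ∘ suc)) (Π-cons S)))

⊎-enumerated : ∀ {m n} {S : Setoid a ℓ} {T : Setoid c ℓ′} →
               Enumerated m S → Enumerated n T → Enumerated (m + n) (S ⊎ₛ T)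
⊎-enumerated e f =
  Inv.trans +↔⊎ (Inv.trans (Inv.sym (⊎.Pointwise-≡↔≡ _ _)) (e ⊎-inverse f))

module _ (R : FiniteCommutativeRing c ℓ) where
  open FiniteCommutativeRing R using (Carrier; 0#; 1#; 1≉0; *-identityʳ; zeroˡ)
    renaming (sym to ≈-sym; trans to ≈-trans)
  open Setoid (classes R) using (_≈_) renaming (refl to ≈ᴱ-refl; sym to ≈ᴱ-sym; trans to ≈ᴱ-trans)

  -- `1#` annihilates `0#`; if the classes agreed it would annihilate `1#` too, so 1 = 1 * 1 = 0.
  0≉ᴱ1 : ¬ (0# ≈ 1#)
  0≉ᴱ1 e = 1≉0 (≈-trans (≈-sym (*-identityʳ 1#)) (proj₁ (≈ᴱ⇒ann R {0#} {1#} e) (zeroˡ 1#)))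

  -- The two points of `Fin 2` stand for the classes of 0 and 1. Injectivity rests on `0≉ᴱ1` and the
  -- definition of a vertex, surjectivity on the decidability of equality of classes.
  V⊎2⤖R_E : Bijection (vertices R ⊎ₛ setoid (Fin 2)) (classes R)
  V⊎2⤖R_E = record
    { to        = to
    ; cong      = λ {x} {y} → to-cong {x} {y}
    ; bijective = (λ {x} {y} → to-injective {x} {y}) , λ y → from y , λ {z} e →
        ≈ᴱ-trans {to z} {to (from y)} {y} (to-cong {z} {from y} e) (to-from y)
    }
    where
    to : Setoid.Carrier (vertices R ⊎ₛ setoid (Fin 2)) → Carrier
    to (inj₁ (x , _))   = x
    to (inj₂ zero)       = 0#
    to (inj₂ (suc zero)) = 1#

    to-cong : ∀ {x y} → Setoid._≈_ (vertices R ⊎ₛ setoid (Fin 2)) x y → to x ≈ to y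
    to-cong (inj₁ e)            = e
    to-cong {inj₂ x} (inj₂ refl) = ≈ᴱ-refl {to (inj₂ x)}

    to-injective : ∀ {x y} → to x ≈ to y → Setoid._≈_ (vertices R ⊎ₛ setoid (Fin 2)) x y
    to-injective {inj₁ _}               {inj₁ _}               e = inj₁ e
    to-injective {inj₁ (_ , x≉0 , _)}   {inj₂ zero}            e = contradiction e x≉0
    to-injective {inj₁ (_ , _ , x≉1)}   {inj₂ (suc zero)}      e = contradiction e x≉1
    to-injective {inj₂ zero}            {inj₁ (y , y≉0 , _)}   e = contradiction (≈ᴱ-sym {0#} {y} e) y≉0
    to-injective {inj₂ (suc zero)}      {inj₁ (y , _ , y≉1)}   e = contradiction (≈ᴱ-sym {1#} {y} e) y≉1
    to-injective {inj₂ zero}            {inj₂ zero}            e = inj₂ refl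
    to-injective {inj₂ zero}            {inj₂ (suc zero)}      e = contradiction e 0≉ᴱ1
    to-injective {inj₂ (suc zero)}      {inj₂ zero}            e = contradiction (≈ᴱ-sym {1#} {0#} e) 0≉ᴱ1
    to-injective {inj₂ (suc zero)}      {inj₂ (suc zero)}      e = inj₂ refl

    from : Carrier → Setoid.Carrier (vertices R ⊎ₛ setoid (Fin 2))
    from y with _≈ᴱ?_ R y 0# | _≈ᴱ?_ R y 1#
    ... | yes _  | _      = inj₂ zero
    ... | no _   | yes _  = inj₂ (suc zero)
    ... | no y≉0 | no y≉1 = inj₁ (y , y≉0 , y≉1)

    to-from : ∀ y → to (from y) ≈ y
    to-from y with _≈ᴱ?_ R y 0# | _≈ᴱ?_ R y 1#
    ... | yes e | _     = ≈ᴱ-sym {y} {0#} e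
    ... | no _  | yes e = ≈ᴱ-sym {y} {1#} e
    ... | no _  | no _  = ≈ᴱ-refl {y}

  #R_E≡#V+2 : # (R_E R) ≡ # (V (Γ_E R)) + 2
  #R_E≡#V+2 = size-unique (FiniteSetoid.finite (R_E R))
    (Inv.trans (⊎-enumerated (enumerated (FiniteSetoid.finite (V (Γ_E R)))) (Inv.refl (setoid (Fin 2))))
               (Bijection⇒Inverse V⊎2⤖R_E))

module _ (R : Fin r → CommutativeRing c ℓ) where
  open CommutativeRing

  single : ∀ i → Carrier (R i) → Carrier (∏ R)
  single i t j with i ≟ j
  ... | yes refl = t
  ... | no _     = 0# (R j)

  single-diagonal : ∀ i t → _≈_ (R i) (single i t i) t
  single-diagonal i t with i ≟ i
  ... | yes refl = CommutativeRing.refl (R i)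
  ... | no i≢i   = contradiction _≡_.refl i≢i

  -- Away from `i` the second factor is 0, so an annihilator of one coordinate extends by zero to an
  -- annihilator of the whole family.
  *-single : ∀ f i t → _≈_ (R i) (_*_ (R i) (f i) t) (0# (R i)) →
             _≈_ (∏ R) (_*_ (∏ R) f (single i t)) (0# (∏ R))
  *-single f i t ft≈0 j with i ≟ j
  ... | yes refl = ft≈0
  ... | no _     = zeroʳ (R j) (f j)

-- Evaluating annihilators at elements supported in one coordinate recovers
-- each ann (φ x i) from ann x.
module _ (R : FiniteCommutativeRing c ℓ) (Rs : Fin r → FiniteCommutativeRing c′ ℓ′)
         (R≅∏Rs : commutativeRing R ≅ ∏ (commutativeRing ∘ Rs)) where

  private
    module R  = FiniteCommutativeRing R
    module Rs i = FiniteCommutativeRing (Rs i)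
    P : CommutativeRing _ _
    P = ∏ (commutativeRing ∘ Rs)
    module P  = CommutativeRing P
    φ : R.Carrier → P.Carrier
    φ = proj₁ R≅∏Rs
    open RingMorphisms.IsRingIsomorphism (proj₂ R≅∏Rs)

    ψ : P.Carrier → R.Carrier
    ψ f = proj₁ (surjective f)

    φ-ψ : ∀ f → φ (ψ f) P.≈ f
    φ-ψ f = proj₂ (surjective f) R.refl

    *-zero⁺ : ∀ {x t} → x R.* t R.≈ R.0# → φ x P.* φ t P.≈ P.0#
    *-zero⁺ {x} {t} xt≈0 =
      P.trans (P.sym (*-homo x t)) (P.trans (⟦⟧-cong xt≈0) 0#-homo)

    *-zero⁻ : ∀ {x t} → φ x P.* φ t P.≈ P.0# → x R.* t R.≈ R.0#
    *-zero⁻ {x} {t} e = injective (P.trans (*-homo x t) (P.trans e (P.sym 0#-homo)))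

  ann-⊆⁺ : ∀ {x y} → (∀ {t} → ann R x t → ann R y t) →
           ∀ i {t} → ann (Rs i) (φ x i) t → ann (Rs i) (φ y i) t
  ann-⊆⁺ {x} {y} x⊆y i {t} xt≈0 = Rs.trans i
    (Rs.*-congˡ i (Rs.sym i (Rs.trans i (φ-ψ e i) (single-diagonal (commutativeRing ∘ Rs) i t))))
    -- Read from the inside: `e` extends `t` by zero, its preimage `ψ e` annihilates `x`, hence `y`,
    -- and coordinate `i` of the image of that equation is the claim up to `φ-ψ` and
    -- `single-diagonal`.
    (*-zero⁺ (x⊆y (*-zero⁻ (P.trans (P.*-congˡ {φ x} (φ-ψ e))
      (*-single (commutativeRing ∘ Rs) (φ x) i t xt≈0)))) i)
    where e = single (commutativeRing ∘ Rs) i t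

  ann-⊆⁻ : ∀ {x y} → (∀ i {t} → ann (Rs i) (φ x i) t → ann (Rs i) (φ y i) t) →
           ∀ {t} → ann R x t → ann R y t
  ann-⊆⁻ x⊆y xt≈0 = *-zero⁻ λ i → x⊆y i (*-zero⁺ xt≈0 i)

  -- `ann-⊆⁺` makes `φ` well defined on classes and `ann-⊆⁻` makes it injective; any choice of
  -- representatives in the factors is hit through `ψ`.
  R_E⤖ΠR_E : Bijection (classes R) (Πₛ (classes ∘ Rs))
  R_E⤖ΠR_E = record
    { to        = φ
    ; cong      = λ {x} {y} → φ-cong {x} {y}
    ; bijective = (λ {x} {y} e → ann⇒≈ᴱ R {x} {y}
        ( ann-⊆⁻ (λ i → proj₁ (≈ᴱ⇒ann (Rs i) {φ x i} {φ y i} (e i)))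
        , ann-⊆⁻ (λ i → proj₂ (≈ᴱ⇒ann (Rs i) {φ x i} {φ y i} (e i)))))
      , λ f → ψ f , λ {z} e i → Setoid.trans (classes (Rs i)) {φ z i} {φ (ψ f) i} {f i}
          (φ-cong {z} {ψ f} e i) (≈⇒≈ᴱ (Rs i) (φ-ψ f i))
    }
    where
    φ-cong : ∀ {x y} → Setoid._≈_ (classes R) x y → Setoid._≈_ (Πₛ (classes ∘ Rs)) (φ x) (φ y)
    φ-cong {x} {y} e i with ≈ᴱ⇒ann R {x} {y} e
    ... | x⊆y , y⊆x = ann⇒≈ᴱ (Rs i) {φ x i} {φ y i} (ann-⊆⁺ x⊆y i , ann-⊆⁺ y⊆x i)

  #R_E≡∏#R_E : # (R_E R) ≡ product (tabulate (λ i → # (R_E (Rs i))))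
  #R_E≡∏#R_E = size-unique (FiniteSetoid.finite (R_E R))
    (Inv.trans (Π-enumerated r (λ i → enumerated (FiniteSetoid.finite (R_E (Rs i)))))
               (Inv.sym (Bijection⇒Inverse R_E⤖ΠR_E)))

-- Since n ≤ m + n, the integer difference is the natural one, where cancellation applies.
m≡m+n-n : ∀ m n → + m ≡ + (m + n) - + n
m≡m+n-n m n = sym (trans (ℤ.m-n≡m⊖n (m + n) n)
  (trans (ℤ.⊖-≥ (ℕ.m≤n+m n m)) (cong +_ (ℕ.m+n∸n≡m m n))))

theorem3p2 : ∀ {c ℓ c′ ℓ′} (R : FiniteCommutativeRing c ℓ)
    (r : ℕ) → r ≥ 1 →
    (Rs : Fin r → FiniteCommutativeRing c′ ℓ′) →
    (∀ i → IsLocal (commutativeRing (Rs i))) →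
    commutativeRing R ≅ ∏ (λ i → commutativeRing (Rs i)) →
    (+ # (V (Γ_E R))
    ≡ + product (tabulate (λ i → # (V (Γ_E (Rs i))) + 2)) - + 2)
    × (+ product (tabulate (λ i → # (V (Γ_E (Rs i))) + 2)) - + 2
    ≡ + product (tabulate (λ i → # (R_E (Rs i)))) - + 2)
theorem3p2 R r _ Rs _ R≅∏Rs =
    -- All counting is done additively over the naturals; 2 is subtracted only here, in the
    -- integers.
    trans (m≡m+n-n (# (V (Γ_E R))) 2) (cong (λ k → + k - + 2) V+2≡∏V+2)
  , cong (λ k → + k - + 2) (sym ∏R_E≡∏V+2)
  where
  ∏R_E≡∏V+2 : product (tabulate (λ i → # (R_E (Rs i)))) ≡
              product (tabulate (λ i → # (V (Γ_E (Rs i))) + 2))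
  ∏R_E≡∏V+2 = cong product (tabulate-cong (λ i → #R_E≡#V+2 (Rs i)))

  V+2≡∏V+2 : # (V (Γ_E R)) + 2 ≡ product (tabulate (λ i → # (V (Γ_E (Rs i))) + 2))
  V+2≡∏V+2 = trans (sym (#R_E≡#V+2 R)) (trans (#R_E≡∏#R_E R Rs R≅∏Rs) ∏R_E≡∏V+2)
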